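{- Let $G$ be a twin-free finite simple graph with no isolated vertices and let $t \in \mathbb{N}$. (i) If $G = K_2$, then $\det(G) = 1$ and $\det(\mu^{(t)}(G)) = 2$. (ii) If $G \neq K_2$, then any minimum size determining set for $G$ (viewed as a set of level-$0$ vertices of $\mu^{(t)}(G)$) is a minimum size determining set for $\mu^{(t)}(G)$, and $\det(\mu^{(t)}(G)) = \det(G)$.
   Context: For $t \in \mathbb{N}$ and a graph $G$ with $V(G)=\{v_1,\dots,v_n\}$, the generalized Mycielskian $\mu^{(t)}(G)$ has vertex set $\{u_i^s : 1\le i\le n,\ 0\le s\le t\} \cup \{w\}$, with $u_i^0$ identified with $v_i$ (so $G$ is the induced subgraph on level $0$). For each edge $v_iv_j$ of $G$ it has edges $u_i^0u_j^0$ and $u_i^su_j^{s+1}$, $u_j^su_i^{s+1}$ for $0 \le s < t$; also edges $u_i^t w$ for $1 \le i \le n$; no other edges. A set $S$ of vertices of a graph $H$ is a determining set if the only automorphism of $H$ fixing every vertex of $S$ is the identity; $\det(H)$ is the minimum size of a determining set. Two vertices are twins if they have the same open neighborhood; a graph is twin-free if it has no pair of distinct twins. -}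

module Defs where

open import Data.Nat using (ℕ; zero; suc; _+_; _*_; _≤_; _≡ᵇ_)
open import Data.Bool using (Bool; true; false; if_then_else_; _∧_; _∨_)
open import Data.Fin using (Fin; toℕ; splitAt; remQuot; join; combine; _↑ˡ_)
import Data.Fin as F
open import Data.Fin.Subset using (Subset; _∈_; ∣_∣)
open import Data.Fin.Permutation using (Permutation′; _⟨$⟩ʳ_)
open import Data.Vec using (tabulate; lookup)
open import Data.Product using (Σ; ∃; _×_; _,_)
open import Data.Sum using (_⊎_; inj₁; inj₂)
open import Relation.Binary.PropositionalEquality using (_≡_; _≢_)

Graph : ℕ → Set
Graph n = Fin n → Fin n → Bool

IsSimple : ∀ {n} → Graph n → Set
IsSimple {n} G = (∀ i j → G i j ≡ G j i) × (∀ i → G i i ≡ false)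

NoIsolated : ∀ {n} → Graph n → Set
NoIsolated {n} G = ∀ i → ∃ λ j → G i j ≡ true

TwinFree : ∀ {n} → Graph n → Set
TwinFree {n} G = ∀ i j → (∀ k → G i k ≡ G j k) → i ≡ j

IsK2 : ∀ {n} → Graph n → Set
IsK2 {n} G = (n ≡ 2) × (∀ i j → i ≢ j → G i j ≡ true)

IsAut : ∀ {n} → Graph n → Permutation′ n → Set
IsAut {n} G σ = ∀ i j → G (σ ⟨$⟩ʳ i) (σ ⟨$⟩ʳ j) ≡ G i j

IsDetSet : ∀ {n} → Graph n → Subset n → Set
IsDetSet {n} G S = ∀ σ → IsAut G σ → (∀ i → i ∈ S → σ ⟨$⟩ʳ i ≡ i) → ∀ i → σ ⟨$⟩ʳ i ≡ i

IsMinDetSet : ∀ {n} → Graph n → Subset n → Set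
IsMinDetSet {n} G S = IsDetSet G S × (∀ S′ → IsDetSet G S′ → ∣ S ∣ ≤ ∣ S′ ∣)

DetEq : ∀ {n} → Graph n → ℕ → Set
DetEq {n} G k = (∃ λ S → IsDetSet G S × ∣ S ∣ ≡ k) × (∀ S → IsDetSet G S → k ≤ ∣ S ∣)

-- Generalized Mycielskian μ^(t)(G).
-- Vertices u_i^s (s : Fin (suc t), i : Fin n) and w, encoded in
-- Fin (suc t * n + 1): the first suc t * n elements are the u_i^s
-- (via remQuot / combine), the last one is w.

MVert : ℕ → ℕ → Set
MVert t n = (Fin (suc t) × Fin n) ⊎ Fin 1

decode : ∀ t n → Fin (suc t * n + 1) → MVert t n
decode t n x with splitAt (suc t * n) x
... | inj₁ y = inj₁ (remQuot {suc t} n y)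
... | inj₂ z = inj₂ z

uVert : ∀ t n → Fin (suc t) → Fin n → Fin (suc t * n + 1)
uVert t n s i = combine s i ↑ˡ 1

mycAdj : ∀ t n → Graph n → MVert t n → MVert t n → Bool
mycAdj t n G (inj₁ (s , i)) (inj₁ (s′ , j)) =
  if ((toℕ s ≡ᵇ 0) ∧ (toℕ s′ ≡ᵇ 0)) ∨ (suc (toℕ s) ≡ᵇ toℕ s′) ∨ (suc (toℕ s′) ≡ᵇ toℕ s)
  then G i j else false
mycAdj t n G (inj₁ (s , i)) (inj₂ _) = toℕ s ≡ᵇ t
mycAdj t n G (inj₂ _) (inj₁ (s′ , j)) = toℕ s′ ≡ᵇ t
mycAdj t n G (inj₂ _) (inj₂ _) = false

Mycielskian : ∀ t {n} → Graph n → Graph (suc t * n + 1)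
Mycielskian t {n} G x y = mycAdj t n G (decode t n x) (decode t n y)

liftLevel0 : ∀ t {n} → Subset n → Subset (suc t * n + 1)
liftLevel0 t {n} S = tabulate λ x → pick (decode t n x)
  where
  pick : MVert t n → Bool
  pick (inj₁ (s , i)) = if toℕ s ≡ᵇ 0 then lookup S i else false
  pick (inj₂ _) = false

{-# OPTIONS --safe #-}
module Submission where

-- An automorphism f of μ⁽ᵗ⁾(G) fixing the apex w preserves the distance to w, hence the levels. It
-- restricts to an automorphism of G on level 0, and twin-freeness propagates this restriction upwards
-- from each level to the next; so Aut(G) is the stabilizer of w, and determining sets of G lift.
-- Conversely a determining set of μ⁽ᵗ⁾(G) projects to one of G by forgetting levels.
--
-- It remains to see that f fixes w when G ≠ K₂. Each neighbour y of w has a shadow: a y′ not adjacent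
-- to w with N(y) ∖ {w} ⊆ N(y′). If f moves w to x = u_i^s, then x inherits this property, which forces
-- the neighbours of i to have no neighbour but i. By twin-freeness i has a single neighbour, so x has
-- degree at most 2, whereas w has degree |V(G)| ≥ 3.
--
-- For K₂ the Mycielskian is an odd cycle: two reflections generate a group acting transitively, so each
-- vertex is fixed by a nontrivial automorphism, while w with one end of K₂ is a determining set.

open import Defs
open import Data.Bool using (Bool; true; false; _∧_; _∨_; if_then_else_)
open import Data.Bool.Properties using (T-≡; T-∨)
open import Data.Empty using (⊥; ⊥-elim)
open import Data.Fin using (Fin; zero; suc; toℕ; fromℕ; fromℕ<; inject₁; splitAt; join; combine; _↑ʳ_)
open import Data.Fin.Permutation using (Permutation′; _⟨$⟩ʳ_; _⟨$⟩ˡ_; permutation; inverseˡ; inverseʳ; reverse)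
open import Data.Fin.Properties using (_≟_; toℕ-injective; toℕ-fromℕ; toℕ-fromℕ<; toℕ-inject₁; toℕ<n; toℕ≤pred[n]; splitAt-↑ˡ; splitAt-↑ʳ; remQuot-combine; combine-remQuot; join-splitAt)
open import Data.Fin.Subset using (Subset; inside; outside; _∈_; _∪_; ⁅_⁆; ∣_∣) renaming (⊥ to ∅)
open import Data.Fin.Subset.Properties using (x∈⁅x⁆; ∣⁅x⁆∣≡1; ∣⊥∣≡0; p⊆q⇒∣p∣≤∣q∣; p⊆p∪q; q⊆p∪q)
open import Data.Nat using (ℕ; zero; suc; pred; parity; _+_; _*_; _∸_; _≤_; z≤n; s≤s; s≤s⁻¹; _≡ᵇ_)
open import Data.Nat.Properties using (m+[n∸m]≡n; pred[n]≤n; ≤-refl; ≤-reflexive; ≤-trans; ≤-antisym; <-irrefl; ≮⇒≥; n≤1+n; m≤n⇒m≤1+n; m≤m+n; +-suc; +-identityʳ; suc-injective; +-monoʳ-≤; ≡ᵇ⇒≡; ≡⇒≡ᵇ; _≤?_; ≰⇒>; module ≤-Reasoning)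
open import Data.Parity using (Parity; 0ℙ; 1ℙ; _⁻¹)
open import Data.Parity.Properties using (⁻¹-selfInverse; ⁻¹-involutive; ⁻¹-injective; suc-homo-⁻¹; +-homo-+; p+p≡0ℙ; p≢p⁻¹)
open import Data.Product using (∃; _×_; _,_; proj₁; proj₂)
open import Data.Sum using (_⊎_; inj₁; inj₂)
open import Data.Sum.Properties using (inj₁-injective)
open import Data.Vec using ([]; _∷_; here; there; lookup)
open import Data.Vec.Properties using (lookup∘tabulate; []=⇒lookup; lookup⇒[]=)
open import Function using (_∘_; _∋_; Equivalence)
open import Relation.Binary.PropositionalEquality
open import Relation.Nullary using (¬_; yes; no; contradiction)

-- Cardinality of subsets

∣p∪q∣≤∣p∣+∣q∣ : ∀ {n} (p q : Subset n) → ∣ p ∪ q ∣ ≤ ∣ p ∣ + ∣ q ∣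
∣p∪q∣≤∣p∣+∣q∣ []            []            = z≤n
∣p∪q∣≤∣p∣+∣q∣ (outside ∷ p) (outside ∷ q) = ∣p∪q∣≤∣p∣+∣q∣ p q
∣p∪q∣≤∣p∣+∣q∣ (outside ∷ p) (inside  ∷ q) =
  ≤-trans (s≤s (∣p∪q∣≤∣p∣+∣q∣ p q)) (≤-reflexive (sym (+-suc ∣ p ∣ ∣ q ∣)))
∣p∪q∣≤∣p∣+∣q∣ (inside  ∷ p) (outside ∷ q) = s≤s (∣p∪q∣≤∣p∣+∣q∣ p q)
∣p∪q∣≤∣p∣+∣q∣ (inside  ∷ p) (inside  ∷ q) =
  s≤s (≤-trans (∣p∪q∣≤∣p∣+∣q∣ p q) (+-monoʳ-≤ ∣ p ∣ (n≤1+n ∣ q ∣)))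

∣p∪⁅x⁆∣≤1+∣p∣ : ∀ {n} (p : Subset n) x → ∣ p ∪ ⁅ x ⁆ ∣ ≤ suc ∣ p ∣
∣p∪⁅x⁆∣≤1+∣p∣ p x = begin
  ∣ p ∪ ⁅ x ⁆ ∣      ≤⟨ ∣p∪q∣≤∣p∣+∣q∣ p ⁅ x ⁆ ⟩
  ∣ p ∣ + ∣ ⁅ x ⁆ ∣  ≡⟨ cong (∣ p ∣ +_) (∣⁅x⁆∣≡1 x) ⟩
  ∣ p ∣ + 1          ≡⟨ +-suc ∣ p ∣ 0 ⟩
  suc (∣ p ∣ + 0)    ≡⟨ cong suc (+-identityʳ ∣ p ∣) ⟩
  suc ∣ p ∣          ∎
  where open ≤-Reasoning

-- A value inj₂ _ marks a point where the partial function h is undefined.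
image-cover : ∀ {N n} (h : Fin N → Fin n ⊎ Fin 1) (S : Subset N) →
  ∃ λ (P : Subset n) → ∣ P ∣ ≤ ∣ S ∣ × (∀ x i → x ∈ S → h x ≡ inj₁ i → i ∈ P)
image-cover {n = n} h [] = ∅ , ≤-reflexive (∣⊥∣≡0 n) , λ _ _ ()
image-cover h (outside ∷ S) with image-cover (h ∘ suc) S
... | P , P≤S , cov = P , P≤S , λ { (suc x) i (there x∈S) e → cov x i x∈S e }
image-cover h (inside ∷ S) with image-cover (h ∘ suc) S | h zero in h0
... | P , P≤S , cov | inj₂ _ = P , m≤n⇒m≤1+n P≤S , λ where
  zero    i here        e → contradiction (trans (sym h0) e) λ ()
  (suc x) i (there x∈S) e → cov x i x∈S e
... | P , P≤S , cov | inj₁ k = P ∪ ⁅ k ⁆ , ≤-trans (∣p∪⁅x⁆∣≤1+∣p∣ P k) (s≤s P≤S) , λ where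
  zero    i here        e → q⊆p∪q P ⁅ k ⁆ (subst (_∈ ⁅ k ⁆) (inj₁-injective (trans (sym h0) e)) (x∈⁅x⁆ k))
  (suc x) i (there x∈S) e → p⊆p∪q ⁅ k ⁆ (cov x i x∈S e)

∣p∣≤0⇒x∉p : ∀ {n} {p : Subset n} → ∣ p ∣ ≤ 0 → ∀ {x} → ¬ (x ∈ p)
∣p∣≤0⇒x∉p {p = inside  ∷ p} ()
∣p∣≤0⇒x∉p {p = outside ∷ p} p≤0 (there x∈p) = ∣p∣≤0⇒x∉p p≤0 x∈p

∣p∣≤1⇒p⊆singleton : ∀ {n} (p : Subset (suc n)) → ∣ p ∣ ≤ 1 → ∃ λ x → ∀ y → y ∈ p → x ≡ y
∣p∣≤1⇒p⊆singleton (inside ∷ p) (s≤s p≤0) = zero , λ where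
  zero    _           → refl
  (suc y) (there y∈p) → ⊥-elim (∣p∣≤0⇒x∉p p≤0 y∈p)
-- The subset is empty here, so `zero` is only a default value.
∣p∣≤1⇒p⊆singleton {zero} (outside ∷ []) _ = zero , λ { zero () ; (suc ()) _ }
∣p∣≤1⇒p⊆singleton {suc n} (outside ∷ p) p≤1 with ∣p∣≤1⇒p⊆singleton p p≤1
... | x , only = suc x , λ { (suc y) (there y∈p) → cong suc (only y y∈p) }

-- Automorphisms

-- Stated over an arbitrary vertex type, so that automorphisms of the Mycielskian act on `MVert` and
-- can be analysed by matching on levels; `IsAut⇒Auto` and `Auto⇒perm` translate to and from
-- permutations of `Fin`.
record Auto {V : Set} (A : V → V → Bool) : Set where
  field
    to from : V → V
    to-from : ∀ v → to (from v) ≡ v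
    from-to : ∀ v → from (to v) ≡ v
    pres    : ∀ u v → A (to u) (to v) ≡ A u v

  to-injective : ∀ {u v} → to u ≡ to v → u ≡ v
  to-injective {u} {v} e = trans (sym (from-to u)) (trans (cong from e) (from-to v))

open Auto

module _ {V : Set} {A : V → V → Bool} where

  inverse : Auto A → Auto A
  inverse f .to = from f
  inverse f .from = to f
  inverse f .to-from = from-to f
  inverse f .from-to = to-from f
  inverse f .pres u v =
    trans (sym (pres f (from f u) (from f v))) (cong₂ A (to-from f u) (to-from f v))

  infixr 9 _∘ᵃ_
  _∘ᵃ_ : Auto A → Auto A → Auto A
  (f ∘ᵃ g) .to = to f ∘ to g
  (f ∘ᵃ g) .from = from g ∘ from f
  (f ∘ᵃ g) .to-from v = trans (cong (to f) (to-from g _)) (to-from f v)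
  (f ∘ᵃ g) .from-to v = trans (cong (from g) (from-to f _)) (from-to g v)
  (f ∘ᵃ g) .pres u v = trans (pres f _ _) (pres g u v)

  Nontrivial : Auto A → Set
  Nontrivial f = ∃ λ v → to f v ≢ v

  NontrivialStabilizer : V → Set
  NontrivialStabilizer x = ∃ λ (f : Auto A) → to f x ≡ x × Nontrivial f

  -- Conjugation by α carries the stabilizer of x to that of α x, so having a nontrivial stabilizer
  -- is constant on orbits. This spreads the property from `w` over the whole odd cycle in the K₂
  -- case.
  stabilizer-conjugate : (α : Auto A) → ∀ {x} → NontrivialStabilizer x → NontrivialStabilizer (to α x)
  stabilizer-conjugate α {x} (f , fx , v , fv) =
    α ∘ᵃ f ∘ᵃ inverse α
    , cong (to α) (trans (cong (to f) (from-to α x)) fx)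
    , to α v
    , λ e → fv (trans (cong (to f) (sym (from-to α v))) (to-injective α e))

-- Vertices of the Mycielskian

encode : ∀ t n → MVert t n → Fin (suc t * n + 1)
encode t n (inj₁ (s , i)) = uVert t n s i
encode t n (inj₂ z)       = (suc t * n) ↑ʳ z

decode-encode : ∀ t n v → decode t n (encode t n v) ≡ v
decode-encode t n (inj₁ (s , i))
  rewrite splitAt-↑ˡ (suc t * n) (combine s i) 1 = cong inj₁ (remQuot-combine s i)
decode-encode t n (inj₂ z) rewrite splitAt-↑ʳ (suc t * n) 1 z = refl

encode-decode : ∀ t n x → encode t n (decode t n x) ≡ x
encode-decode t n x with splitAt (suc t * n) x in eq
... | inj₁ y = trans (cong (join (suc t * n) 1 ∘ inj₁) (combine-remQuot {suc t} n y))
                     (trans (cong (join (suc t * n) 1) (sym eq)) (join-splitAt (suc t * n) 1 x))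
... | inj₂ z = trans (cong (join (suc t * n) 1) (sym eq)) (join-splitAt (suc t * n) 1 x)

data _∼_ (a b : ℕ) : Set where
  base : a ≡ 0 → b ≡ 0 → a ∼ b
  up   : suc a ≡ b → a ∼ b
  down : suc b ≡ a → a ∼ b

∼-sym : ∀ {a b} → a ∼ b → b ∼ a
∼-sym (base p q) = base q p
∼-sym (up p)     = down p
∼-sym (down p)   = up p

adjacentLevels : ℕ → ℕ → Bool
adjacentLevels a b = ((a ≡ᵇ 0) ∧ (b ≡ᵇ 0)) ∨ (suc a ≡ᵇ b) ∨ (suc b ≡ᵇ a)

≡ᵇ-true⇒≡ : ∀ a b → (a ≡ᵇ b) ≡ true → a ≡ b
≡ᵇ-true⇒≡ a b e = ≡ᵇ⇒≡ a b (Equivalence.from T-≡ e)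

≡⇒≡ᵇ-true : ∀ {a b} → a ≡ b → (a ≡ᵇ b) ≡ true
≡⇒≡ᵇ-true {a} {b} e = Equivalence.to T-≡ (≡⇒≡ᵇ a b e)

adjacentLevels⇒∼ : ∀ a b → adjacentLevels a b ≡ true → a ∼ b
adjacentLevels⇒∼ zero    zero    _ = base refl refl
adjacentLevels⇒∼ zero    (suc b) e with b | e
... | zero | _ = up refl
adjacentLevels⇒∼ (suc a) b e
  with Equivalence.to (T-∨ {suc (suc a) ≡ᵇ b}) (Equivalence.from T-≡ e)
... | inj₁ p = up (≡ᵇ⇒≡ (suc (suc a)) b p)
... | inj₂ p = down (≡ᵇ⇒≡ (suc b) (suc a) p)

∼⇒adjacentLevels : ∀ {a b} → a ∼ b → adjacentLevels a b ≡ true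
∼⇒adjacentLevels (base refl refl) = refl
∼⇒adjacentLevels {zero}  (up refl) = refl
∼⇒adjacentLevels {suc a} (up refl) =
  Equivalence.to T-≡ (Equivalence.from (T-∨ {a ≡ᵇ a}) (inj₁ (≡⇒≡ᵇ a a refl)))
∼⇒adjacentLevels {suc a} {b} (down refl) =
  Equivalence.to T-≡ (Equivalence.from (T-∨ {suc (suc a) ≡ᵇ b}) (inj₂ (≡⇒≡ᵇ a a refl)))

level : ∀ {t} r → r ≤ t → ∃ λ (s : Fin (suc t)) → toℕ s ≡ r
level r r≤t = fromℕ< (s≤s r≤t) , toℕ-fromℕ< (s≤s r≤t)

pattern w = inj₂ zero
pattern u s i = inj₁ (s , i)

u-injectiveʳ : ∀ {t n} {s r : Fin (suc t)} {i j : Fin n} → u s i ≡ (MVert t n ∋ u r j) → i ≡ j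
u-injectiveʳ refl = refl

true⇔⇒≡ : ∀ {a b} → (a ≡ true → b ≡ true) → (b ≡ true → a ≡ true) → a ≡ b
true⇔⇒≡ {false} {false} _ _ = refl
true⇔⇒≡ {false} {true}  _ g = g refl
true⇔⇒≡ {true}  f _ = sym (f refl)

Fin1-unique : (i j : Fin 1) → i ≡ j
Fin1-unique zero zero = refl

Fin2-edge : (G : Graph 2) → (∀ i j → G i j ≡ G j i) → ∀ {i j} → i ≢ j → G i j ≡ true →
  ∀ a b → a ≢ b → G a b ≡ true
Fin2-edge G symG {zero}     {zero}     i≢j _ = contradiction refl i≢j
Fin2-edge G symG {suc zero} {suc zero} i≢j _ = contradiction refl i≢j
Fin2-edge G symG {i} {j} i≢j g zero       zero       a≢b = contradiction refl a≢b
Fin2-edge G symG {i} {j} i≢j g (suc zero) (suc zero) a≢b = contradiction refl a≢b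
Fin2-edge G symG {zero}     {suc zero} _ g zero       (suc zero) _ = g
Fin2-edge G symG {zero}     {suc zero} _ g (suc zero) zero       _ = trans (symG _ _) g
Fin2-edge G symG {suc zero} {zero}     _ g zero       (suc zero) _ = trans (symG _ _) g
Fin2-edge G symG {suc zero} {zero}     _ g (suc zero) zero       _ = g

-- Adjacency and automorphisms of the Mycielskian

module Myc {n} (G : Graph n) (t : ℕ) (symG : ∀ i j → G i j ≡ G j i) where

  V : Set
  V = MVert t n

  A : V → V → Bool
  A = mycAdj t n G

  data _~_ : V → V → Set where
    uu : ∀ {s r i j} → toℕ s ∼ toℕ r → G i j ≡ true → u s i ~ u r j
    uw : ∀ {s i} → toℕ s ≡ t → u s i ~ w
    wu : ∀ {s i} → toℕ s ≡ t → w ~ u s i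

  ~-sym : ∀ {x y} → x ~ y → y ~ x
  ~-sym (uu l g) = uu (∼-sym l) (trans (symG _ _) g)
  ~-sym (uw e)   = wu e
  ~-sym (wu e)   = uw e

  A⇒~ : ∀ x y → A x y ≡ true → x ~ y
  A⇒~ (u s i) (u r j) e with adjacentLevels (toℕ s) (toℕ r) in l | e
  ... | true | g = uu (adjacentLevels⇒∼ _ _ l) g
  A⇒~ (u s i) w e = uw (≡ᵇ-true⇒≡ (toℕ s) t e)
  A⇒~ w (u r j) e = wu (≡ᵇ-true⇒≡ (toℕ r) t e)

  ~⇒A : ∀ {x y} → x ~ y → A x y ≡ true
  ~⇒A (uu l g) rewrite ∼⇒adjacentLevels l = g
  ~⇒A (uw e)   = ≡⇒≡ᵇ-true e
  ~⇒A (wu e)   = ≡⇒≡ᵇ-true e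

  to-~ : (f : Auto A) → ∀ {x y} → x ~ y → to f x ~ to f y
  to-~ f e = A⇒~ _ _ (trans (pres f _ _) (~⇒A e))

  from-~ : (f : Auto A) → ∀ {x y} → to f x ~ y → x ~ from f y
  from-~ f {x} {y} e = subst (_~ from f y) (from-to f x) (to-~ (inverse f) e)

  IsAut⇒Auto : (σ : Permutation′ (suc t * n + 1)) → IsAut (Mycielskian t G) σ → Auto A
  IsAut⇒Auto σ aut .to v = decode t n (σ ⟨$⟩ʳ encode t n v)
  IsAut⇒Auto σ aut .from v = decode t n (σ ⟨$⟩ˡ encode t n v)
  IsAut⇒Auto σ aut .to-from v =
    trans (cong (λ x → decode t n (σ ⟨$⟩ʳ x)) (encode-decode t n _))
          (trans (cong (decode t n) (inverseʳ σ)) (decode-encode t n v))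
  IsAut⇒Auto σ aut .from-to v =
    trans (cong (λ x → decode t n (σ ⟨$⟩ˡ x)) (encode-decode t n _))
          (trans (cong (decode t n) (inverseˡ σ)) (decode-encode t n v))
  IsAut⇒Auto σ aut .pres x y =
    trans (aut (encode t n x) (encode t n y)) (cong₂ A (decode-encode t n x) (decode-encode t n y))

  Auto⇒perm : Auto A → Permutation′ (suc t * n + 1)
  Auto⇒perm f = permutation (encode t n ∘ to f ∘ decode t n) (encode t n ∘ from f ∘ decode t n)
    (λ x → trans (cong (encode t n ∘ to f) (decode-encode t n _))
                 (trans (cong (encode t n) (to-from f _)) (encode-decode t n x)))
    (λ x → trans (cong (encode t n ∘ from f) (decode-encode t n _))
                 (trans (cong (encode t n) (from-to f _)) (encode-decode t n x)))

  Auto⇒IsAut : ∀ f → IsAut (Mycielskian t G) (Auto⇒perm f)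
  Auto⇒IsAut f x y =
    trans (cong₂ A (decode-encode t n (to f x′)) (decode-encode t n (to f y′))) (pres f x′ y′)
    where
    x′ = decode t n x
    y′ = decode t n y

  Det : (V → Set) → Set
  Det P = ∀ (f : Auto A) → (∀ v → P v → to f v ≡ v) → ∀ v → to f v ≡ v

  Det⇒IsDetSet : ∀ S → Det (λ v → encode t n v ∈ S) → IsDetSet (Mycielskian t G) S
  Det⇒IsDetSet S det σ aut fix x =
    trans (sym (encode-decode t n _)) (trans (cong (encode t n) fixed) (encode-decode t n x))
    where
    fixed : decode t n (σ ⟨$⟩ʳ x) ≡ decode t n x
    fixed = trans (cong (λ y → decode t n (σ ⟨$⟩ʳ y)) (sym (encode-decode t n x)))
      (det (IsAut⇒Auto σ aut) (λ v v∈S → trans (cong (decode t n) (fix _ v∈S)) (decode-encode t n v))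
           (decode t n x))

  IsDetSet⇒Det : ∀ S → IsDetSet (Mycielskian t G) S → Det (λ v → encode t n v ∈ S)
  IsDetSet⇒Det S det f fix v =
    trans (sym (decode-encode t n _)) (trans (cong (decode t n) fixed) (decode-encode t n v))
    where
    fixed : encode t n (to f v) ≡ encode t n v
    fixed = trans (cong (encode t n ∘ to f) (sym (decode-encode t n v)))
      (det (Auto⇒perm f) (Auto⇒IsAut f)
           (λ x x∈S → trans (cong (encode t n) (fix (decode t n x) (subst (_∈ S) (sym (encode-decode t n x)) x∈S)))
                            (encode-decode t n x))
           (encode t n v))

  -- The right-hand side is a value of the function local to `liftLevel0`, which cannot be named here.
  lookup-lift : ∀ (S : Subset n) x → lookup (liftLevel0 t S) x ≡ _
  lookup-lift S x = lookup∘tabulate _ x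

  lookup-lift-level0 : ∀ S x i → decode t n x ≡ u zero i → lookup (liftLevel0 t S) x ≡ lookup S i
  -- Abstracting `decode t n x` inside the type of `lookup-lift S x` lets the unnamed local function
  -- compute once the vertex is known.
  lookup-lift-level0 S x i eq with decode t n x | lookup-lift S x | eq
  ... | _ | e | refl = e

  ∈-lift⁺ : ∀ S i → i ∈ S → encode t n (u zero i) ∈ liftLevel0 t S
  ∈-lift⁺ S i i∈S = lookup⇒[]= _ _
    (trans (lookup-lift-level0 S _ i (decode-encode t n (u zero i))) ([]=⇒lookup i∈S))

  ∈-lift⁻ : ∀ S x → x ∈ liftLevel0 t S → ∃ λ i → i ∈ S × x ≡ encode t n (u zero i)
  ∈-lift⁻ S x x∈ with decode t n x in eq | trans (sym (lookup-lift S x)) ([]=⇒lookup x∈)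
  -- On a higher level or at `w` the looked-up value is `false`, which makes `e` absurd; only level
  -- 0 remains.
  ... | u zero i | e = i , lookup⇒[]= i S e , trans (sym (encode-decode t n x)) (cong (encode t n) eq)

  ∣lift∣≤ : ∀ S → ∣ liftLevel0 t S ∣ ≤ ∣ S ∣
  ∣lift∣≤ S with image-cover (λ i → inj₁ (encode t n (u zero i))) S
  ... | P , P≤S , cov = ≤-trans (p⊆q⇒∣p∣≤∣q∣ lift⊆P) P≤S
    where
    lift⊆P : ∀ {x} → x ∈ liftLevel0 t S → x ∈ P
    lift⊆P {x} x∈ with ∈-lift⁻ S x x∈
    ... | i , i∈S , refl = cov i x i∈S refl

  -- Lifting automorphisms and projecting determining sets

  liftAuto : (σ : Permutation′ n) → IsAut G σ → Auto A
  liftAuto σ aut .to (u s i) = u s (σ ⟨$⟩ʳ i)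
  liftAuto σ aut .to w = w
  liftAuto σ aut .from (u s i) = u s (σ ⟨$⟩ˡ i)
  liftAuto σ aut .from w = w
  liftAuto σ aut .to-from (u s i) = cong (u s) (inverseʳ σ)
  liftAuto σ aut .to-from w = refl
  liftAuto σ aut .from-to (u s i) = cong (u s) (inverseˡ σ)
  liftAuto σ aut .from-to w = refl
  liftAuto σ aut .pres (u s i) (u r j) =
    cong (λ b → if adjacentLevels (toℕ s) (toℕ r) then b else false) (aut i j)
  liftAuto σ aut .pres (u s i) w = refl
  liftAuto σ aut .pres w (u r j) = refl
  liftAuto σ aut .pres w w = refl

  forgetLevel : V → Fin n ⊎ Fin 1
  forgetLevel (u s i)  = inj₁ i
  forgetLevel (inj₂ z) = inj₂ z

  -- If σ fixes every index occurring in S, then its lift fixes S pointwise, the apex being fixed by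
  -- every lift. So the lift is trivial, and level 0 shows that σ is trivial.
  projectDetSet : ∀ S → IsDetSet (Mycielskian t G) S → ∃ λ P → IsDetSet G P × ∣ P ∣ ≤ ∣ S ∣
  projectDetSet S det with image-cover (forgetLevel ∘ decode t n) S
  ... | P , P≤S , cov = P , detP , P≤S
    where
    detP : IsDetSet G P
    detP σ aut fix i with IsDetSet⇒Det S det (liftAuto σ aut) fixS (u zero i)
      where
      fixS : ∀ v → encode t n v ∈ S → to (liftAuto σ aut) v ≡ v
      fixS (u s i) v∈S = cong (u s) (fix i (cov _ i v∈S (cong forgetLevel (decode-encode t n (u s i)))))
      fixS w v∈S = refl
    ... | e = u-injectiveʳ e

  -- The height of v is t + 1 minus its distance to w, if G has no isolated vertices.
  height : V → ℕ
  height (u s i) = toℕ s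
  height w = suc t

  ~⇒height≤ : ∀ {x y} → x ~ y → height y ≤ suc (height x)
  ~⇒height≤ (uu (base p q) _) = subst (_≤ _) (sym q) z≤n
  ~⇒height≤ (uu (up p) _)     = ≤-reflexive (sym p)
  ~⇒height≤ (uu (down p) _)   = m≤n⇒m≤1+n (≤-trans (n≤1+n _) (≤-reflexive p))
  ~⇒height≤ (uw e)            = ≤-reflexive (cong suc (sym e))
  ~⇒height≤ (wu {s} e)        = ≤-trans (toℕ≤pred[n] s) (m≤n⇒m≤1+n (n≤1+n t))

  height≤1+t : ∀ v → height v ≤ suc t
  height≤1+t (u s i) = m≤n⇒m≤1+n (toℕ≤pred[n] s)
  height≤1+t w = ≤-refl

  -- Automorphisms fixing the apex

  module _ (noIso : NoIsolated G) where

    higherNeighbour : ∀ s i → ∃ λ y → u s i ~ y × height y ≡ suc (toℕ s)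
    higherNeighbour s i with suc (toℕ s) ≤? t
    ... | yes s<t with level (suc (toℕ s)) s<t | noIso i
    ...   | r , r≡ | j , g = u r j , uu (up (sym r≡)) g , r≡
    higherNeighbour s i | no s≮t = w , uw s≡t , cong suc (sym s≡t)
      where
      s≡t : toℕ s ≡ t
      s≡t = ≤-antisym (toℕ≤pred[n] s) (≮⇒≥ s≮t)

    -- Induction on the distance d to `w`. A neighbour y of v one step higher satisfies the bound by
    -- induction, and f v is adjacent to f y, so its height is at most one less than that of f y.
    height-mono : (f : Auto A) → to f w ≡ w → ∀ d v → height v + d ≡ suc t → height v ≤ height (to f v)
    height-mono f fw d w _ = ≤-reflexive (cong height (sym fw))
    height-mono f fw zero (u s i) e =
      contradiction (toℕ<n s) (<-irrefl (trans (sym (+-identityʳ _)) e))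
    height-mono f fw (suc d) (u s i) e with higherNeighbour s i
    ... | y , x~y , hy = s≤s⁻¹ (begin
      suc (toℕ s)                    ≡⟨ sym hy ⟩
      height y                       ≤⟨ height-mono f fw d y (trans (cong (_+ d) hy) (trans (sym (+-suc _ d)) e)) ⟩
      height (to f y)                ≤⟨ ~⇒height≤ (to-~ f x~y) ⟩
      suc (height (to f (u s i)))    ∎)
      where open ≤-Reasoning

    height-preserved : (f : Auto A) → to f w ≡ w → ∀ v → height (to f v) ≡ height v
    height-preserved f fw v = ≤-antisym
      (≤-trans (mono (inverse f) (trans (cong (from f) (sym fw)) (from-to f w)) (to f v))
               (≤-reflexive (cong height (from-to f v))))
      (mono f fw v)
      where
      mono : ∀ g → to g w ≡ w → ∀ v → height v ≤ height (to g v)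
      mono g gw v = height-mono g gw (suc t ∸ height v) v (m+[n∸m]≡n (height≤1+t v))

    to-level : (f : Auto A) → to f w ≡ w → ∀ s i → ∃ λ j → to f (u s i) ≡ u s j
    to-level f fw s i with to f (u s i) | height-preserved f fw (u s i)
    ... | u r j | e = j , cong (λ s → u s j) (toℕ-injective e)
    ... | w     | e = contradiction (toℕ<n s) (<-irrefl (sym e))

    restrict : (f : Auto A) → to f w ≡ w →
      ∃ λ σ → IsAut G σ × (∀ i → to f (u zero i) ≡ u zero (σ ⟨$⟩ʳ i))
    restrict f fw = σ , aut , fσ
      where
      f⁻¹w : from f w ≡ w
      f⁻¹w = trans (cong (from f) (sym fw)) (from-to f w)

      π π⁻¹ : Fin n → Fin n
      π i = proj₁ (to-level f fw zero i)
      π⁻¹ i = proj₁ (to-level (inverse f) f⁻¹w zero i)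

      fσ : ∀ i → to f (u zero i) ≡ u zero (π i)
      fσ i = proj₂ (to-level f fw zero i)

      f⁻¹σ : ∀ i → from f (u zero i) ≡ u zero (π⁻¹ i)
      f⁻¹σ i = proj₂ (to-level (inverse f) f⁻¹w zero i)

      σ : Permutation′ n
      σ = permutation π π⁻¹
        (λ i → u-injectiveʳ (trans (sym (fσ _)) (trans (cong (to f) (sym (f⁻¹σ i))) (to-from f _))))
        (λ i → u-injectiveʳ (trans (sym (f⁻¹σ _)) (trans (cong (from f) (sym (fσ i))) (from-to f _))))

      aut : IsAut G σ
      aut i j = trans (cong₂ A (sym (fσ i)) (sym (fσ j))) (pres f (u zero i) (u zero j))

    A-consecutive : ∀ {s r} → toℕ s ≡ suc (toℕ r) → ∀ i k → A (u s i) (u r k) ≡ G i k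
    A-consecutive s≡ i k rewrite ∼⇒adjacentLevels (down (sym s≡)) = refl

    -- Induction on the level. If f sends u_i^s to u_j^s while level s - 1 is fixed pointwise, then
    -- both vertices have the same neighbours on that level, which makes i and j twins in G.
    fixesLevel0⇒id : TwinFree G → (f : Auto A) → to f w ≡ w →
      (∀ i → to f (u zero i) ≡ u zero i) → ∀ v → to f v ≡ v
    fixesLevel0⇒id twinFree f fw f0 w = fw
    fixesLevel0⇒id twinFree f fw f0 (u s i) = go (toℕ s) s i refl
      where
      go : ∀ m s i → toℕ s ≡ m → to f (u s i) ≡ u s i
      go zero zero i _ = f0 i
      go (suc m) s i s≡
        with to-level f fw s i
           | level m (≤-trans (n≤1+n m) (≤-trans (≤-reflexive (sym s≡)) (toℕ≤pred[n] s)))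
      ... | j , fs | r , r≡ = trans fs (cong (u s) (twinFree j i twins))
        where
        s≡1+r : toℕ s ≡ suc (toℕ r)
        s≡1+r = trans s≡ (cong suc (sym r≡))

        twins : ∀ k → G j k ≡ G i k
        twins k = begin
          G j k                            ≡⟨ sym (A-consecutive s≡1+r j k) ⟩
          A (u s j) (u r k)                ≡⟨ cong₂ A (sym fs) (sym (go m r k r≡)) ⟩
          A (to f (u s i)) (to f (u r k))  ≡⟨ pres f _ _ ⟩
          A (u s i) (u r k)                ≡⟨ A-consecutive s≡1+r i k ⟩
          G i k                            ∎
          where open ≡-Reasoning

    fixesDetSet⇒id : TwinFree G → ∀ S → IsDetSet G S → (f : Auto A) → to f w ≡ w →
      (∀ i → i ∈ S → to f (u zero i) ≡ u zero i) → ∀ v → to f v ≡ v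
    fixesDetSet⇒id twinFree S det f fw fS with restrict f fw
    ... | σ , aut , fσ = fixesLevel0⇒id twinFree f fw
      (λ i → trans (fσ i) (cong (u zero) (det σ aut (λ j j∈S → u-injectiveʳ (trans (sym (fσ j)) (fS j j∈S))) i)))

  -- Shadowed vertices and the invariance of the apex

  -- The apex w is distinguished by this property when G is not K₂: a neighbour u_i^t
  -- of w is shadowed by u_i^{t-2} (by u_i^0 if t = 1).
  Shadowed : V → Set
  Shadowed x = ∀ y → x ~ y → ∃ λ y′ → ¬ (x ~ y′) × (∀ z → z ≢ x → y ~ z → y′ ~ z)

  Shadowed-to : (f : Auto A) → ∀ {x} → Shadowed x → Shadowed (to f x)
  Shadowed-to f {x} sh y fx~y with sh (from f y) (from-~ f fx~y)
  ... | y′ , x≁y′ , dom = to f y′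
    , (λ e → x≁y′ (subst (x ~_) (from-to f y′) (from-~ f e)))
    , λ z z≢ y~z → subst (to f y′ ~_) (to-from f z)
        (to-~ f (dom (from f z) (λ e → z≢ (trans (sym (to-from f z)) (cong (to f) e))) (to-~ (inverse f) y~z)))

  Shadowed-w : 1 ≤ t → Shadowed w
  Shadowed-w (s≤s {n = t′} z≤n) (u s i) (wu s≡t)
    with level (pred t′) (≤-trans (pred[n]≤n {t′}) (n≤1+n t′))
  ... | r , r≡ = u r i , w≁ , dom
    where
    w≁ : ¬ (w ~ u r i)
    w≁ (wu r≡t) = <-irrefl (trans (sym r≡) r≡t) (s≤s (pred[n]≤n {t′}))

    -- Apart from the apex, level t = suc t′ is adjacent only to level t′. Level `pred t′` is
    -- adjacent to t′ as well: by an edge inside level 0 if t′ = 0, from one level below otherwise.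
    lower : ∀ {a b q} → a ≡ suc t′ → b ≤ suc t′ → q ≡ pred t′ → a ∼ b → q ∼ b
    lower refl _ _ (base () _)
    lower refl b≤ _ (up refl) = contradiction b≤ (<-irrefl refl)
    lower {b = zero}  refl _ refl (down refl) = base refl refl
    lower {b = suc b} refl _ refl (down refl) = up refl

    dom : ∀ z → z ≢ w → u s i ~ z → u r i ~ z
    dom w z≢w _ = contradiction refl z≢w
    dom (u q j) _ (uu l g) = uu (lower s≡t (toℕ≤pred[n] q) r≡ l) g

  -- Two admissible steps between levels that do not return to s. The edges inside level 0 serve s =
  -- 0 (path 0, 0, 1) and s = 1 (path 1, 0, 0); from a higher level the path descends twice.
  levelPath : 1 ≤ t → ∀ (s : Fin (suc t)) → ∃ λ (p : Fin (suc t)) → ∃ λ (q : Fin (suc t)) →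
    toℕ s ∼ toℕ p × toℕ p ∼ toℕ q × toℕ q ≢ toℕ s
  levelPath (s≤s _) zero          = zero , suc zero , base refl refl , up refl , λ ()
  levelPath (s≤s _) (suc zero)    = zero , zero , down refl , base refl refl , λ ()
  levelPath (s≤s _) (suc (suc s)) = inject₁ (suc s) , inject₁ (inject₁ s)
    , down (cong (λ m → suc (suc m)) (toℕ-inject₁ s))
    , down (cong suc (toℕ-inject₁ (inject₁ s)))
    , λ e → <-irrefl (trans (sym (trans (toℕ-inject₁ (inject₁ s)) (toℕ-inject₁ s))) e) (s≤s (n≤1+n _))

  -- Suppose k ≠ i. With levels s, p, q from `levelPath`, the neighbour u_j^p of x = u_i^s has a
  -- shadow adjacent to both u_k^s and u_i^q. If the shadow is some u_l^r, the first adjacency makes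
  -- r adjacent to s and the second makes l adjacent to i, so the shadow is a neighbour of x, which
  -- is excluded. If it is `w`, then s = t = q, against q ≠ s.
  Shadowed-u⇒leaf : 1 ≤ t → ∀ s i → Shadowed (u s i) → ∀ j k → G i j ≡ true → G j k ≡ true → k ≡ i
  Shadowed-u⇒leaf 1≤t s i sh j k gij gjk with k ≟ i
  ... | yes k≡i = k≡i
  ... | no  k≢i with levelPath 1≤t s
  ...   | p , q , s∼p , p∼q , q≢s with sh (u p j) (uu s∼p gij)
  ...     | y′ , x≁y′ , dom = ⊥-elim (absurd y′ x≁y′
    (dom (u s k) (λ { refl → k≢i refl }) (uu (∼-sym s∼p) gjk))
    (dom (u q i) (λ { refl → q≢s refl }) (uu p∼q (trans (symG j i) gij))))
    where
    absurd : ∀ y → ¬ (u s i ~ y) → y ~ u s k → y ~ u q i → ⊥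
    absurd (u r l) x≁y (uu r∼s _) (uu _ gli) = x≁y (uu (∼-sym r∼s) (trans (symG i l) gli))
    absurd w _ (wu s≡t) (wu q≡t) = q≢s (trans q≡t (sym s≡t))

  module _ {i j : Fin n} (only : ∀ k → G i k ≡ true → k ≡ j) where

    -- Splits the neighbours into a lower and a higher class. The lower class is on level
    -- `pred (toℕ s)`, which for s = 0 is level 0 itself and so covers the edges inside it.
    neighbour-split : ∀ s {y} → u s i ~ y →
      (∃ λ r → toℕ r ≡ pred (toℕ s) × y ≡ u r j) ⊎ height y ≡ suc (toℕ s)
    neighbour-split s (uu {r = r} (base p q) g) = inj₁ (r , trans q (sym (cong pred p)) , cong (u r) (only _ g))
    neighbour-split s (uu (up p) g)             = inj₂ (sym p)
    neighbour-split s (uu {r = r} (down p) g)   = inj₁ (r , cong pred p , cong (u r) (only _ g))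
    neighbour-split s (uw e)                    = inj₂ (cong suc (sym e))

    sameHeight⇒≡ : ∀ s {y z} → u s i ~ y → u s i ~ z → height y ≡ height z → y ≡ z
    sameHeight⇒≡ s (uu {r = r} _ g) (uu _ g′) e =
      cong₂ (λ r j → u r j) (toℕ-injective e) (trans (only _ g) (sym (only _ g′)))
    sameHeight⇒≡ s (uu {r = r} _ _) (uw _) e = contradiction (toℕ<n r) (<-irrefl e)
    sameHeight⇒≡ s (uw _) (uu {r = r} _ _) e = contradiction (toℕ<n r) (<-irrefl (sym e))
    sameHeight⇒≡ s (uw _) (uw _) _ = refl

    sameLower : ∀ {m} {y z : V} → (∃ λ r → toℕ r ≡ m × y ≡ u r j) → (∃ λ r → toℕ r ≡ m × z ≡ u r j) → y ≡ z
    sameLower (r , r≡ , refl) (r′ , r′≡ , refl) = cong (λ r → u r j) (toℕ-injective (trans r≡ (sym r′≡)))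

    -- Pigeonhole: two of the three neighbours fall into the same class of `neighbour-split`, and
    -- each class holds at most one vertex because j is the only neighbour of i.
    atMostTwoNeighbours : ∀ s {x y z} → u s i ~ x → u s i ~ y → u s i ~ z → x ≢ y → x ≢ z → y ≢ z → ⊥
    atMostTwoNeighbours s ex ey ez x≢y x≢z y≢z
      with neighbour-split s ex | neighbour-split s ey | neighbour-split s ez
    ... | inj₁ p | inj₁ q | _      = x≢y (sameLower p q)
    ... | inj₁ p | inj₂ _ | inj₁ q = x≢z (sameLower p q)
    ... | inj₂ _ | inj₁ p | inj₁ q = y≢z (sameLower p q)
    ... | inj₂ p | inj₂ q | _      = x≢y (sameHeight⇒≡ s ex ey (trans p (sym q)))
    ... | inj₂ p | inj₁ _ | inj₂ q = x≢z (sameHeight⇒≡ s ex ez (trans p (sym q)))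
    ... | inj₁ _ | inj₂ p | inj₂ q = y≢z (sameHeight⇒≡ s ey ez (trans p (sym q)))

fixes-w : ∀ {n} (G : Graph n) t → 1 ≤ t → IsSimple G → TwinFree G → NoIsolated G → ¬ IsK2 G →
  (f : Auto (mycAdj t n G)) → to f w ≡ w
fixes-w {n} G t 1≤t (symG , irrG) twinFree noIso notK2 f = go (to f w) refl
  where
  open Myc G t symG

  impossible : ∀ s i → to f w ≡ u s i → ⊥
  impossible s i fw with noIso i
  ... | j , gij = byOrder n refl
    where
    leaf : ∀ j k → G i j ≡ true → G j k ≡ true → k ≡ i
    leaf = Shadowed-u⇒leaf 1≤t s i (subst Shadowed fw (Shadowed-to f (Shadowed-w 1≤t)))

    i≢j : i ≢ j
    i≢j refl = contradiction (trans (sym gij) (irrG i)) λ ()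

    -- By `leaf`, j and k both have i as their sole neighbour, hence they are twins.
    only : ∀ k → G i k ≡ true → k ≡ j
    only k gik = twinFree k j λ l → true⇔⇒≡
      (λ gkl → trans (cong (G j) (leaf k l gik gkl)) (trans (symG j i) gij))
      (λ gjl → trans (cong (G k) (leaf j l gij gjl)) (trans (symG k i) gik))

    neighbour : ∀ k → u s i ~ to f (u (fromℕ t) k)
    neighbour k = subst (_~ to f (u (fromℕ t) k)) fw (to-~ f (wu (toℕ-fromℕ t)))

    distinct : ∀ {k l} → k ≢ l → to f (u (fromℕ t) k) ≢ to f (u (fromℕ t) l)
    distinct k≢l e = k≢l (u-injectiveʳ (to-injective f e))

    byOrder : ∀ m → n ≡ m → ⊥
    byOrder 0 refl = contradiction i λ ()
    byOrder 1 refl = i≢j (Fin1-unique i j)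
    byOrder 2 refl = notK2 (refl , Fin2-edge G symG i≢j gij)
    -- Three neighbours of `w` on level t have distinct images, all adjacent to f w = u_i^s.
    byOrder (suc (suc (suc m))) refl =
      atMostTwoNeighbours only s (neighbour zero) (neighbour (suc zero)) (neighbour (suc (suc zero)))
        (distinct λ ()) (distinct λ ()) (distinct λ ())

  go : ∀ y → to f w ≡ y → to f w ≡ w
  go (u s i) fw = ⊥-elim (impossible s i fw)
  go w       fw = fw

-- The case of K₂

module K2 (G : Graph 2) (t : ℕ) (simple : IsSimple G) (edge : ∀ i j → i ≢ j → G i j ≡ true) where

  open Myc G t (proj₁ simple)

  edge⇒≢ : ∀ {i j} → G i j ≡ true → i ≢ j
  edge⇒≢ g refl = contradiction (trans (sym g) (proj₂ simple _)) λ ()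

  reverse-aut : IsAut G reverse
  reverse-aut zero       zero       = trans (proj₂ simple _) (sym (proj₂ simple _))
  reverse-aut zero       (suc zero) = proj₁ simple _ _
  reverse-aut (suc zero) zero       = proj₁ simple _ _
  reverse-aut (suc zero) (suc zero) = trans (proj₂ simple _) (sym (proj₂ simple _))

  τ : Auto A
  τ = liftAuto reverse reverse-aut

  -- Deleting `w` and the edge inside level 0 cuts the cycle into two paths; the parity tells which
  -- one contains u_i^s. The summand t normalizes it so that the path of u_0^t has `0ℙ`. An edge
  -- between consecutive levels changes both level and index, hence keeps the parity.
  direction : ℕ → Fin 2 → Parity
  direction s i = parity (s + (toℕ i + t))

  direction-suc : ∀ {s r} i → suc s ≡ r → direction r i ≡ direction s i ⁻¹
  direction-suc {s} i refl = sym (⁻¹-selfInverse (suc-homo-⁻¹ (s + (toℕ i + t))))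

  direction-other : ∀ s {i j} → i ≢ j → direction s j ≡ direction s i ⁻¹
  direction-other s {zero}     {zero}     i≢j = contradiction refl i≢j
  direction-other s {zero}     {suc zero} _ rewrite +-suc s t = sym (⁻¹-selfInverse (suc-homo-⁻¹ (s + t)))
  direction-other s {suc zero} {zero}     _ rewrite +-suc s t = sym (suc-homo-⁻¹ (s + t))
  direction-other s {suc zero} {suc zero} i≢j = contradiction refl i≢j

  direction-step : ∀ {s r i j} → suc s ≡ r → i ≢ j → direction r j ≡ direction s i
  direction-step {s} {r} {i} {j} e i≢j = trans (direction-suc j e)
    (trans (cong _⁻¹ (direction-other s i≢j)) (⁻¹-involutive _))

  direction-top : direction t zero ≡ 0ℙ
  direction-top = trans (+-homo-+ t t) (p+p≡0ℙ (parity t))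

  sameDirection⇒≡ : ∀ {s i j} → direction s i ≡ direction s j → i ≡ j
  sameDirection⇒≡ {s} {i} {j} e with i ≟ j
  ... | yes i≡j = i≡j
  ... | no  i≢j = contradiction (trans e (direction-other s i≢j)) (p≢p⁻¹ _)

  -- μ⁽ᵗ⁾(K₂) is the cycle w, u₀ᵗ, u₁ᵗ⁻¹, …, u₁ᵗ, w. The relation K is the graph of its reflection
  -- interchanging w and u₀ᵗ, which preserves the lower index; with τ it generates the dihedral group.
  data K : V → V → Set where
    rest : ∀ {s i} → toℕ s ≡ 0 → direction (toℕ s) i ≡ 1ℙ → K (u s i) (u s i)
    dn   : ∀ {s r i} → suc (toℕ r) ≡ toℕ s → direction (toℕ s) i ≡ 1ℙ → K (u s i) (u r i)
    up   : ∀ {s r i} → suc (toℕ s) ≡ toℕ r → direction (toℕ s) i ≡ 0ℙ → K (u s i) (u r i)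
    top  : ∀ {s i} → toℕ s ≡ t → direction (toℕ s) i ≡ 0ℙ → K (u s i) w
    apex : ∀ {s i} → toℕ s ≡ t → direction (toℕ s) i ≡ 0ℙ → K w (u s i)

  0≢1 : ∀ {p} → p ≡ 0ℙ → p ≡ 1ℙ → ⊥
  0≢1 refl ()

  K-sym : ∀ {x y} → K x y → K y x
  K-sym (rest e d)  = rest e d
  K-sym (dn {i = i} e d) = up e (⁻¹-injective (trans (sym (direction-suc i e)) d))
  K-sym (up {i = i} e d) = dn e (trans (direction-suc i e) (cong _⁻¹ d))
  K-sym (top e d)  = apex e d
  K-sym (apex e d) = top e d

  -- Level and direction of the first vertex determine the constructor, so mixed cases are
  -- contradictory. At the apex the image is unique because on a fixed level the direction
  -- determines the index.
  K-functional : ∀ {x y z} → K x y → K x z → y ≡ z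
  K-functional (rest _ _) (rest _ _) = refl
  K-functional (rest e _) (dn e′ _) = contradiction (trans e′ e) λ ()
  K-functional (rest _ d) (up _ d′) = ⊥-elim (0≢1 d′ d)
  K-functional (rest _ d) (top _ d′) = ⊥-elim (0≢1 d′ d)
  K-functional (dn e _) (rest e′ _) = contradiction (trans e e′) λ ()
  K-functional (dn e _) (dn e′ _) = cong (λ s → u s _) (toℕ-injective (suc-injective (trans e (sym e′))))
  K-functional (dn _ d) (up _ d′) = ⊥-elim (0≢1 d′ d)
  K-functional (dn _ d) (top _ d′) = ⊥-elim (0≢1 d′ d)
  K-functional (up _ d) (rest _ d′) = ⊥-elim (0≢1 d d′)
  K-functional (up _ d) (dn _ d′) = ⊥-elim (0≢1 d d′)
  K-functional (up e _) (up e′ _) = cong (λ s → u s _) (toℕ-injective (trans (sym e) e′))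
  K-functional (up {r = r} e _) (top e′ _) =
    contradiction (toℕ<n r) (<-irrefl (trans (sym e) (cong suc e′)))
  K-functional (top _ d) (rest _ d′) = ⊥-elim (0≢1 d d′)
  K-functional (top _ d) (dn _ d′) = ⊥-elim (0≢1 d d′)
  K-functional (top e′ _) (up {r = r} e _) =
    contradiction (toℕ<n r) (<-irrefl (trans (sym e) (cong suc e′)))
  K-functional (top _ _) (top _ _) = refl
  K-functional (apex {s} {i} e d) (apex {s′} {j} e′ d′) with toℕ-injective (trans e (sym e′))
  ... | refl = cong (u s) (sameDirection⇒≡ {toℕ s} (trans d (sym d′)))

  K-total : ∀ x → ∃ (K x)
  K-total w = u (fromℕ t) zero
    , apex (toℕ-fromℕ t) (trans (cong (λ s → direction s zero) (toℕ-fromℕ t)) direction-top)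
  K-total (u s i) with direction (toℕ s) i in d
  K-total (u zero i)    | 1ℙ = u zero i , rest refl d
  K-total (u (suc s) i) | 1ℙ = u (inject₁ s) i , dn (cong suc (toℕ-inject₁ s)) d
  K-total (u s i)       | 0ℙ with suc (toℕ s) ≤? t
  ... | no s≮t = w , top (≤-antisym (toℕ≤pred[n] s) (≮⇒≥ s≮t)) d
  ... | yes s<t with level (suc (toℕ s)) s<t
  ...   | r , r≡ = u r i , up (sym r≡) d

  -- Both ends have the same direction, so the reflection moves them the same way. At the boundary,
  -- either the lower end rests on level 0 and the upper one joins it there, or the upper end moves
  -- from level t to `w`.
  K-up : ∀ {s r i j x y} → suc (toℕ s) ≡ toℕ r → i ≢ j → K (u s i) x → K (u r j) y → x ~ y
  K-up e i≢j Kx Ky with direction-step e i≢j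
  K-up e i≢j (rest _ d)  (rest e′ _)  | _ = contradiction (trans e e′) λ ()
  K-up e i≢j (rest e₀ d) (dn e′ _)   | _ = uu (base e₀ (trans (suc-injective (trans e′ (sym e))) e₀)) (edge _ _ i≢j)
  K-up e i≢j (rest _ d)  (up _ d′)   | q = ⊥-elim (0≢1 d′ (trans q d))
  K-up e i≢j (rest _ d)  (top _ d′)  | q = ⊥-elim (0≢1 d′ (trans q d))
  K-up e i≢j (dn _ d)   (rest e′ _)  | _ = contradiction (trans e e′) λ ()
  K-up e i≢j (dn e₀ d)  (dn e′ _)   | _ = uu (up (trans e₀ (suc-injective (trans e (sym e′))))) (edge _ _ i≢j)
  K-up e i≢j (dn _ d)   (up _ d′)   | q = ⊥-elim (0≢1 d′ (trans q d))
  K-up e i≢j (dn _ d)   (top _ d′)  | q = ⊥-elim (0≢1 d′ (trans q d))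
  K-up e i≢j (up _ d)   (rest _ d′)  | q = ⊥-elim (0≢1 d (trans (sym q) d′))
  K-up e i≢j (up _ d)   (dn _ d′)   | q = ⊥-elim (0≢1 d (trans (sym q) d′))
  K-up e i≢j (up e₀ _)  (up e′ _)   | _ = uu (up (trans (cong suc (trans (sym e₀) e)) e′)) (edge _ _ i≢j)
  K-up e i≢j (up e₀ _)  (top e′ _)  | _ = uw (trans (sym e₀) (trans e e′))
  K-up {r = r} e i≢j (top e₀ _) Ky  | _ =
    contradiction (toℕ<n r) (<-irrefl (trans (sym e) (cong suc e₀)))

  -- The two ends on level 0 have opposite directions: the one with `1ℙ` rests while the other rises
  -- to level 1, or to `w` if t = 0.
  K-base : ∀ {s r i j x y} → toℕ s ≡ 0 → toℕ r ≡ 0 → i ≢ j →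
    direction (toℕ s) i ≡ 1ℙ → K (u s i) x → K (u r j) y → x ~ y
  K-base {s} {r} {i} {j} e e′ i≢j d Kx Ky = go Kx Ky
    where
    d′ : direction (toℕ r) j ≡ 0ℙ
    d′ = trans (direction-other (toℕ r) i≢j)
      (cong _⁻¹ (trans (cong (λ m → direction m i) (trans e′ (sym e))) d))

    go : ∀ {x y} → K (u s i) x → K (u r j) y → x ~ y
    go (dn p _)  _         = contradiction (trans p e) λ ()
    go (up _ q)  _         = ⊥-elim (0≢1 q d)
    go (top _ q) _         = ⊥-elim (0≢1 q d)
    go (rest _ _) (rest _ q) = ⊥-elim (0≢1 d′ q)
    go (rest _ _) (dn _ q)  = ⊥-elim (0≢1 d′ q)
    go (rest _ _) (up p _)  = uu (up (trans (cong suc (trans e (sym e′))) p)) (edge _ _ i≢j)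
    go (rest _ _) (top p _) = uw (trans (trans e (sym e′)) p)

  -- The apex goes to the vertex of direction `0ℙ` on level t. That vertex itself goes to `w`, and
  -- the other one on level t descends, or rests if t = 0.
  K-apex : ∀ {s i x y} → toℕ s ≡ t → K (u s i) x → K w y → x ~ y
  K-apex {i = i} e Kx (apex {r} {j} e′ d′) = go Kx
    where
    other : ∀ {m} → m ≡ t → direction m i ≡ 1ℙ → i ≢ j
    other refl d refl = 0≢1 (trans (cong (λ m → direction m i) (sym e′)) d′) d

    go : ∀ {x} → K (u _ i) x → x ~ u r j
    go (rest p d) = uu (base p (trans e′ (trans (sym e) p))) (edge _ _ (other e d))
    go (dn p d)  = uu (up (trans p (trans e (sym e′)))) (edge _ _ (other e d))
    go (up {r = q} p d) = contradiction (toℕ<n q) (<-irrefl (trans (sym p) (cong suc e)))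
    go (top p d) = wu e′

  K-~ : ∀ {x y x′ y′} → x ~ y → K x x′ → K y y′ → x′ ~ y′
  K-~ (uu (up e) g)   Kx Ky = K-up e (edge⇒≢ g) Kx Ky
  K-~ (uu (down e) g) Kx Ky = ~-sym (K-up e (edge⇒≢ g ∘ sym) Ky Kx)
  -- Exactly one end of the level-0 edge has direction `1ℙ`; `K-base` expects it first.
  K-~ (uu {s} {r} {i} {j} (base e e′) g) Kx Ky with direction (toℕ s) i in d
  ... | 1ℙ = K-base e e′ (edge⇒≢ g) d Kx Ky
  ... | 0ℙ = ~-sym (K-base e′ e (edge⇒≢ g ∘ sym)
    (trans (direction-other (toℕ r) (edge⇒≢ g))
           (cong _⁻¹ (trans (cong (λ m → direction m i) (trans e′ (sym e))) d))) Ky Kx)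
  K-~ (uw e) Kx Ky = K-apex e Kx Ky
  K-~ (wu e) Kx Ky = ~-sym (K-apex e Ky Kx)

  -- The relation is symmetric, total and functional, so the resulting map is an involution and
  -- serves as its own inverse.
  κ : Auto A
  κ = record { to = k ; from = k ; to-from = k-k ; from-to = k-k ; pres = k-pres }
    where
    k : V → V
    k x = proj₁ (K-total x)

    Kk : ∀ x → K x (k x)
    Kk x = proj₂ (K-total x)

    k-k : ∀ x → k (k x) ≡ x
    k-k x = K-functional (Kk (k x)) (K-sym (Kk x))

    k-pres : ∀ x y → A (k x) (k y) ≡ A x y
    k-pres x y = true⇔⇒≡
      (λ e → ~⇒A (K-~ (A⇒~ _ _ e) (K-sym (Kk x)) (K-sym (Kk y))))
      (λ e → ~⇒A (K-~ (A⇒~ _ _ e) (Kk x) (Kk y)))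

  Stabilized : V → Set
  Stabilized = NontrivialStabilizer {A = A}

  Stabilized-K : ∀ {x y} → K x y → Stabilized x → Stabilized y
  Stabilized-K {x} Kxy st = subst Stabilized (K-functional (proj₂ (K-total x)) Kxy) (stabilizer-conjugate κ st)

  Stabilized-τ : ∀ s {i} → Stabilized (u s i) → ∀ j → Stabilized (u s j)
  Stabilized-τ s {zero}     st zero       = st
  Stabilized-τ s {zero}     st (suc zero) = stabilizer-conjugate τ st
  Stabilized-τ s {suc zero} st zero       = stabilizer-conjugate τ st
  Stabilized-τ s {suc zero} st (suc zero) = st

  Stabilized-w : Stabilized w
  Stabilized-w = τ , refl , u zero zero , λ ()

  someDown : ∀ s → ∃ λ i → direction s i ≡ 1ℙ
  someDown s with direction s zero in d
  ... | 1ℙ = zero , d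
  ... | 0ℙ = suc zero , trans (direction-other s {zero} λ ()) (cong _⁻¹ d)

  -- Downward induction on the level, with d = t - s. On level t, `κ` brings the property from `w`
  -- to u_0^t; further down it brings it from the vertex of direction `1ℙ` on level s + 1. Then `τ`
  -- reaches the other vertex of the level.
  Stabilized-u : ∀ d s i → toℕ s + d ≡ t → Stabilized (u s i)
  Stabilized-u zero s i e = Stabilized-τ s (Stabilized-K (apex s≡t dir) Stabilized-w) i
    where
    s≡t : toℕ s ≡ t
    s≡t = trans (sym (+-identityʳ _)) e

    dir : direction (toℕ s) zero ≡ 0ℙ
    dir = trans (cong (λ m → direction m zero) s≡t) direction-top
  Stabilized-u (suc d) s i e
    with level (suc (toℕ s)) (≤-trans (m≤m+n _ d) (≤-reflexive (trans (sym (+-suc _ d)) e)))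
  ... | r , r≡ with someDown (toℕ r)
  ...   | j , dir = Stabilized-τ s (Stabilized-K (dn (sym r≡) dir)
    (Stabilized-u d r j (trans (cong (_+ d) r≡) (trans (sym (+-suc _ d)) e)))) i

  Stabilized-all : ∀ x → Stabilized x
  Stabilized-all w = Stabilized-w
  Stabilized-all (u s i) = Stabilized-u (t ∸ toℕ s) s i (m+[n∸m]≡n (toℕ≤pred[n] s))

  -- A set with at most one element lies in some {x}, and x is fixed by a nontrivial automorphism.
  2≤det : ∀ S → IsDetSet (Mycielskian t G) S → 2 ≤ ∣ S ∣
  2≤det S det with 2 ≤? ∣ S ∣
  ... | yes 2≤S = 2≤S
  ... | no  2≰S with ∣p∣≤1⇒p⊆singleton S (s≤s⁻¹ (≰⇒> 2≰S))
  ...   | x , only with Stabilized-all (decode t 2 x)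
  ...     | f , fx , v , fv≢v = contradiction (IsDetSet⇒Det S det f fixS v) fv≢v
    where
    fixS : ∀ y → encode t 2 y ∈ S → to f y ≡ y
    fixS y y∈S = subst (λ z → to f z ≡ z)
      (trans (cong (decode t 2) (only _ y∈S)) (decode-encode t 2 y)) fx

  1≤detG : ∀ S → IsDetSet G S → 1 ≤ ∣ S ∣
  1≤detG S det with 1 ≤? ∣ S ∣
  ... | yes 1≤S = 1≤S
  ... | no  1≰S = contradiction
    (det reverse reverse-aut (λ i i∈S → ⊥-elim (∣p∣≤0⇒x∉p (s≤s⁻¹ (≰⇒> 1≰S)) i∈S)) zero) λ ()

  endpoint : Subset 2
  endpoint = ⁅ zero ⁆

  detG : IsDetSet G endpoint
  detG σ aut fix zero = fix zero here
  detG σ aut fix (suc zero) with σ ⟨$⟩ʳ suc zero in e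
  ... | suc zero = refl
  ... | zero = contradiction
    (trans (sym (inverseˡ σ)) (trans (cong (σ ⟨$⟩ˡ_) (trans e (sym (fix zero here)))) (inverseˡ σ))) λ ()

  -- For K₂ the reflection `κ` moves the apex, so `w` is added to force an automorphism to fix it;
  -- one end of K₂ on level 0 then determines the rest.
  detSet : Subset (suc t * 2 + 1)
  detSet = liftLevel0 t endpoint ∪ ⁅ encode t 2 w ⁆

  ∣detSet∣≤2 : ∣ detSet ∣ ≤ 2
  ∣detSet∣≤2 = ≤-trans (∣p∪⁅x⁆∣≤1+∣p∣ (liftLevel0 t endpoint) (encode t 2 w)) (s≤s (∣lift∣≤ endpoint))

  detSet-det : TwinFree G → NoIsolated G → IsDetSet (Mycielskian t G) detSet
  detSet-det twinFree noIso = Det⇒IsDetSet detSet λ f fix →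
    fixesDetSet⇒id noIso twinFree endpoint detG f
      (fix w (q⊆p∪q (liftLevel0 t endpoint) ⁅ encode t 2 w ⁆ (x∈⁅x⁆ _)))
      (λ i i∈ → fix (u zero i) (p⊆p∪q ⁅ encode t 2 w ⁆ (∈-lift⁺ endpoint i i∈)))

-- Determining numbers of G and of its Mycielskian

theorem2 : ∀ {n} (G : Graph n) (t : ℕ) → 1 ≤ t →
    IsSimple G → TwinFree G → NoIsolated G →
    (IsK2 G → DetEq G 1 × DetEq (Mycielskian t G) 2) ×
    (¬ IsK2 G →
    (∀ (S : Subset n) → IsMinDetSet G S → IsMinDetSet (Mycielskian t G) (liftLevel0 t S)) ×
    (∀ (k : ℕ) → DetEq G k → DetEq (Mycielskian t G) k))
theorem2 {n} G t 1≤t simple twinFree noIso = caseK2 , λ notK2 → minDet notK2 , detEq notK2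
  where
  open Myc G t (proj₁ simple)

  caseK2 : IsK2 G → DetEq G 1 × DetEq (Mycielskian t G) 2
  caseK2 (refl , edge) =
      ((endpoint , detG , refl) , 1≤detG)
    -- Counting gives only the upper bound 2; the lower one is `2≤det` applied to `detSet` itself.
    , ((detSet , det , ≤-antisym ∣detSet∣≤2 (2≤det detSet det)) , 2≤det)
    where
    open K2 G t simple edge
    det = detSet-det twinFree noIso

  liftDet : ¬ IsK2 G → ∀ S → IsDetSet G S → IsDetSet (Mycielskian t G) (liftLevel0 t S)
  liftDet notK2 S det = Det⇒IsDetSet _ λ f fix →
    fixesDetSet⇒id noIso twinFree S det f (fixes-w G t 1≤t simple twinFree noIso notK2 f)
      (λ i i∈S → fix (u zero i) (∈-lift⁺ S i i∈S))

  lowerBound : ∀ {k} → (∀ P → IsDetSet G P → k ≤ ∣ P ∣) → ∀ S → IsDetSet (Mycielskian t G) S → k ≤ ∣ S ∣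
  lowerBound min S det with projectDetSet S det
  ... | P , detP , P≤S = ≤-trans (min P detP) P≤S

  minDet : ¬ IsK2 G → ∀ S → IsMinDetSet G S → IsMinDetSet (Mycielskian t G) (liftLevel0 t S)
  minDet notK2 S (det , min) =
    liftDet notK2 S det , λ S′ det′ → ≤-trans (∣lift∣≤ S) (lowerBound min S′ det′)

  detEq : ¬ IsK2 G → ∀ k → DetEq G k → DetEq (Mycielskian t G) k
  detEq notK2 k ((S , det , refl) , min) =
    -- The exact size of the lift follows in the same way, since the lift is itself a determining
    -- set and so obeys the lower bound.
    (liftLevel0 t S , det′ , ≤-antisym (∣lift∣≤ S) (lowerBound min _ det′)) , lowerBound min
    where
    det′ = liftDet notK2 S det
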